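{- Let $a$ be an odd integer, let $k,m$ be positive integers with $m\ge 5$, and let $b\in\{1,3,5,\ldots\}$. Then $$\begin{aligned}E_{2^mk+b}^{(a)}-E_b^{(a)}\equiv{}& 2^mk\{(17a^7+162a^5+153a^3+64a^2+180a+192)b^2\\&-(102a^7+216a^5+386a^3-704a)b\\&-(211a^7-10a^5-32a^4+66a^3-267a-224)\\&+2^{m+1}(a^2-1)\}\pmod{2^{m+10}}.\end{aligned}$$
   Context: For a nonzero integer $a$, the sequence $\{E_n^{(a)}\}_{n\ge 0}$ is the sequence of integers defined recursively by $$\sum_{j=0}^{\lfloor n/2\rfloor}\binom{n}{2j}a^{2j}E_{n-2j}^{(a)}=(1-a)^n\quad(n=0,1,2,\ldots).$$ -}

module Defs where

open import Data.Nat.Base as ℕ using (ℕ; zero; suc; ⌊_/2⌋)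
open import Data.Nat.Combinatorics using (_C_)
open import Data.Nat.Induction using (<-rec; <-wellFounded; <-Rec)
import Data.Nat.Properties as ℕ
open import Data.Fin.Base using (Fin; zero; suc; toℕ)
open import Data.Integer.Base using (ℤ; +_; 1ℤ; _+_; _-_; _*_; _^_; -_)
open import Data.Integer.Divisibility using (_∣_)
open import Data.Integer.Properties
  using (+-0-commutativeMonoid; +-assoc; +-comm; +-inverseʳ; +-identityʳ; *-identityˡ)
open import Algebra.Properties.CommutativeMonoid.Sum +-0-commutativeMonoid
  using (sum-syntax; sum⁺-syntax; sum-cong-≗)
open import Induction.WellFounded using (module FixPoint)
open import Relation.Binary.PropositionalEquality
  using (_≡_; refl; cong; cong₂; sym; module ≡-Reasoning)

infix 4 _≡_[mod_]

_≡_[mod_] : ℤ → ℤ → ℕ → Set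
x ≡ y [mod n ] = + n ∣ x - y

n∸2j<n : ∀ n (i : Fin ⌊ n /2⌋) → n ℕ.∸ 2 ℕ.* suc (toℕ i) ℕ.< n
n∸2j<n (suc n) i = ℕ.s≤s (ℕ.m∸n≤m n (toℕ i ℕ.+ 1 ℕ.* suc (toℕ i)))

-- The defining relation solved for its j = 0 term; here j = suc (toℕ i).
E-step : ℤ → ∀ n → <-Rec (λ _ → ℤ) n → ℤ
E-step a n rec =
  (1ℤ - a) ^ n -
  ∑[ i < ⌊ n /2⌋ ]
    (+ (n C (2 ℕ.* suc (toℕ i))) * a ^ (2 ℕ.* suc (toℕ i)) * rec (n∸2j<n n i))

-- The recursion makes sense for every a, so no a ≠ 0 is required.
E : ℤ → ℕ → ℤ
E a = <-rec (λ _ → ℤ) (E-step a)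

E-unfold : ∀ a n → E a n ≡ E-step a n (λ {y} _ → E a y)
E-unfold a n =
  FixPoint.unfold-wfRec <-wellFounded (λ _ → ℤ) (E-step a)
    (λ n eq → cong (λ s → (1ℤ - a) ^ n - s)
      (sum-cong-≗ λ i →
        cong (+ (n C (2 ℕ.* suc (toℕ i))) * a ^ (2 ℕ.* suc (toℕ i)) *_)
             (eq (n∸2j<n n i))))
    {n}

E-recurrence : ∀ a n →
  ∑[ j ≤ ⌊ n /2⌋ ]
    (+ (n C (2 ℕ.* toℕ j)) * a ^ (2 ℕ.* toℕ j) * E a (n ℕ.∸ 2 ℕ.* toℕ j))
  ≡ (1ℤ - a) ^ n
E-recurrence a n = begin
  1ℤ * E a n + S           ≡⟨ cong (_+ S) (*-identityˡ (E a n)) ⟩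
  E a n + S                ≡⟨ cong (_+ S) (E-unfold a n) ⟩
  (1ℤ - a) ^ n - S + S     ≡⟨ +-assoc ((1ℤ - a) ^ n) (- S) S ⟩
  (1ℤ - a) ^ n + (- S + S) ≡⟨ cong (λ z → (1ℤ - a) ^ n + z) (+-comm (- S) S) ⟩
  (1ℤ - a) ^ n + (S - S)   ≡⟨ cong (λ z → (1ℤ - a) ^ n + z) (+-inverseʳ S) ⟩
  (1ℤ - a) ^ n + + 0       ≡⟨ +-identityʳ _ ⟩
  (1ℤ - a) ^ n             ∎
  where
  open ≡-Reasoning
  S : ℤ
  S = ∑[ i < ⌊ n /2⌋ ]
    (+ (n C (2 ℕ.* suc (toℕ i))) * a ^ (2 ℕ.* suc (toℕ i)) * E a (n ℕ.∸ 2 ℕ.* suc (toℕ i)))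

{-# OPTIONS --safe #-}

-- Umbrally, E_n = L(Xⁿ) with X = 1 + 2ax, where the linear functional L on integer-valued
-- polynomials in x is given by L(2^i C(x,i)) = (-1)^i; it satisfies L(f(x+1)) + L(f(x)) = 2 f(0),
-- which for f = (X - a)ⁿ is the recurrence defining E_n.  Multiplication by X² - 1 is divisible
-- by 2 on the basis 2^i C(x,i), so the j-th difference of n ↦ E_n with step 2 is divisible
-- by 2^j.  For an odd argument, in n as well as in the parameter a, a congruence modulo a power
-- of 2 between such "smooth" functions therefore follows from finitely many values.  This settles
-- the case m = 5, k = 1 together with a congruence for the second difference with step 2^m.
-- Since Δ_{2h} = Δ_h² + 2 Δ_h, both congruences propagate from m to m + 1; the second
-- differences are small enough for E_{n + 2^m k} - E_n to be linear in k.
module Submission where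

open import Defs
open import Data.Nat.Base as ℕ using (ℕ; zero; suc; ⌊_/2⌋)
open import Data.Nat.Combinatorics using (_C_; k>n⇒nCk≡0; nCk+nC[k+1]≡[n+1]C[k+1])
open import Data.Nat.Divisibility as ℕ using ()
import Data.Nat.DivMod as ℕ
open import Data.Nat.Induction using (<-rec)
import Data.Nat.Properties as ℕ
import Data.Nat.Tactic.RingSolver as ℕ-Solver
open import Data.Fin.Base using (toℕ)
open import Data.Integer.Base
  using (ℤ; +_; -[1+_]; 0ℤ; 1ℤ; _+_; _-_; _*_; _^_; -_) renaming (suc to sucℤ)
open import Data.Integer.Divisibility using (_∣_)
open import Data.Integer.Divisibility.Signed as Signed
  using (divides; ∣⇒∣ᵤ; ∣m∣n⇒∣m+n; ∣m∣n⇒∣m-n; ∣n⇒∣m*n; ∣m⇒∣-m)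
  renaming (_∣_ to _∣ˢ_; _∣?_ to _∣ˢ?_)
import Data.Integer.DivMod as ℤ
import Data.Integer.Properties as ℤ
open import Data.Integer.Tactic.RingSolver using (solve-∀)
open import Algebra.Properties.CommutativeMonoid.Sum ℤ.+-0-commutativeMonoid
  using (sum-syntax; sum⁺-syntax; sum-cong-≗; ∑-distrib-+)
open import Data.List.Base using (List; []; _∷_)
open import Data.Product.Base using (∃-syntax; _×_; _,_; proj₁)
open import Data.Sum.Base using (inj₁; inj₂)
open import Data.Unit.Base using (⊤; tt)
open import Function.Base using (_∘_)
open import Relation.Binary.PropositionalEquality
open import Relation.Nullary.Decidable.Core using (Dec; toWitness)
open import Relation.Nullary.Negation using (¬_; contradiction)

-- The functional L on the basis 2^i C(x,i).

-- R a n i = L(Xⁿ 2^i C(x,i)); the recursion expresses X · 2^i C(x,i) in the same basis.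
R : ℤ → ℕ → ℕ → ℤ
R a zero    i = (- 1ℤ) ^ i
R a (suc n) i = (1ℤ + + 2 * a * + i) * R a n i + a * + suc i * R a n (suc i)

-- Umbrally (r + c)ⁿ, with `r k` in place of the k-th power of r.
binomialTransform : ℤ → ℕ → (ℕ → ℤ) → ℤ
binomialTransform c zero    r = r 0
binomialTransform c (suc n) r = c * binomialTransform c n r + binomialTransform c n (r ∘ suc)

binomialTransform-linear : ∀ c n x y r s →
  binomialTransform c n (λ k → x * r k + y * s k)
    ≡ x * binomialTransform c n r + y * binomialTransform c n s
binomialTransform-linear c zero    x y r s = refl
binomialTransform-linear c (suc n) x y r s
  rewrite binomialTransform-linear c n x y r s
        | binomialTransform-linear c n x y (r ∘ suc) (s ∘ suc) =
  regroup c x y _ _ _ _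
  where
  regroup : ∀ c x y p q p′ q′ →
    c * (x * p + y * q) + (x * p′ + y * q′) ≡ x * (c * p + p′) + y * (c * q + q′)
  regroup = solve-∀

module _ (a : ℤ) where

  -- U c n i = L((X + c)ⁿ 2^i C(x,i)).
  U : ℤ → ℕ → ℕ → ℤ
  U c n i = binomialTransform c n (λ k → R a k i)

  -- Split one factor X + c off the power: c acts as a scalar, and X acts on the basis by the
  -- recursion of `R`.
  U-step : ∀ c n i →
    U c (suc n) i ≡ (c + (1ℤ + + 2 * a * + i)) * U c n i + a * + suc i * U c n (suc i)
  U-step c n i = trans
    (cong (λ z → c * U c n i + z)
      (binomialTransform-linear c n x y (λ k → R a k i) (λ k → R a k (suc i))))
    (regroup c x y (U c n i) (U c n (suc i)))
    where
    x y : ℤ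
    x = 1ℤ + + 2 * a * + i
    y = a * + suc i
    regroup : ∀ c x y p q → c * p + (x * p + y * q) ≡ (c + x) * p + y * q
    regroup = solve-∀

  -- The identity L(g(x+1)) + L(g(x)) = 2 g(0), where x ↦ x + 1 turns X - a into X + a. The first
  -- part takes g = (X - a)ⁿ. The second takes g = (X - a)ⁿ 2^(i+1) C(x,i+1), which vanishes at 0;
  -- Pascal's rule for C(x+1,i+1) produces the extra term. Since `U-step` raises i, the induction on
  -- n needs both parts together.
  U-reflect : ∀ n →
    (U (- a) n 0 + U a n 0 ≡ + 2 * (1ℤ - a) ^ n) ×
    (∀ i → U (- a) n (suc i) + U a n (suc i) + + 2 * U a n i ≡ 0ℤ)
  U-reflect zero = refl , λ i → cancel ((- 1ℤ) ^ i)
    where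
    cancel : ∀ x → - 1ℤ * x + - 1ℤ * x + + 2 * x ≡ 0ℤ
    cancel = solve-∀
  U-reflect (suc n) with U-reflect n
  ... | at-zero , at-suc = at-zero′ , at-suc′
    where
    open ≡-Reasoning
    expand₀ : ∀ a p p′ q q′ →
      ((- a + (1ℤ + + 2 * a * 0ℤ)) * p + a * 1ℤ * p′)
        + ((a + (1ℤ + + 2 * a * 0ℤ)) * q + a * 1ℤ * q′)
        ≡ (1ℤ - a) * (p + q) + a * (p′ + q′ + + 2 * q)
    expand₀ = solve-∀
    collect₀ : ∀ a w → (1ℤ - a) * (+ 2 * w) + a * 0ℤ ≡ + 2 * ((1ℤ - a) * w)
    collect₀ = solve-∀
    at-zero′ : U (- a) (suc n) 0 + U a (suc n) 0 ≡ + 2 * (1ℤ - a) ^ suc n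
    at-zero′ = begin
      U (- a) (suc n) 0 + U a (suc n) 0
        ≡⟨ cong₂ _+_ (U-step (- a) n 0) (U-step a n 0) ⟩
      _ ≡⟨ expand₀ a (U (- a) n 0) (U (- a) n 1) (U a n 0) (U a n 1) ⟩
      (1ℤ - a) * (U (- a) n 0 + U a n 0) + a * (U (- a) n 1 + U a n 1 + + 2 * U a n 0)
        ≡⟨ cong₂ (λ s t → (1ℤ - a) * s + a * t) at-zero (at-suc 0) ⟩
      (1ℤ - a) * (+ 2 * (1ℤ - a) ^ n) + a * 0ℤ
        ≡⟨ collect₀ a ((1ℤ - a) ^ n) ⟩
      + 2 * (1ℤ - a) ^ suc n ∎
    expand₁ : ∀ a x p p′ q q′ r →
      ((- a + (1ℤ + + 2 * a * (1ℤ + x))) * p + a * (1ℤ + (1ℤ + x)) * p′)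
        + ((a + (1ℤ + + 2 * a * (1ℤ + x))) * q + a * (1ℤ + (1ℤ + x)) * q′)
        + + 2 * ((a + (1ℤ + + 2 * a * x)) * r + a * (1ℤ + x) * q)
        ≡ (- a + (1ℤ + + 2 * a * (1ℤ + x))) * (p + q + + 2 * r)
          + a * (1ℤ + (1ℤ + x)) * (p′ + q′ + + 2 * q)
    expand₁ = solve-∀
    vanish : ∀ s t → s * 0ℤ + t * 0ℤ ≡ 0ℤ
    vanish = solve-∀
    at-suc′ : ∀ i → U (- a) (suc n) (suc i) + U a (suc n) (suc i) + + 2 * U a (suc n) i ≡ 0ℤ
    at-suc′ i = begin
      U (- a) (suc n) (suc i) + U a (suc n) (suc i) + + 2 * U a (suc n) i
        ≡⟨ cong₂ _+_ (cong₂ _+_ (U-step (- a) n (suc i)) (U-step a n (suc i)))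
                     (cong (+ 2 *_) (U-step a n i)) ⟩
      _ ≡⟨ expand₁ a (+ i) (U (- a) n (suc i)) (U (- a) n (2 ℕ.+ i))
                           (U a n (suc i)) (U a n (2 ℕ.+ i)) (U a n i) ⟩
      s * (U (- a) n (suc i) + U a n (suc i) + + 2 * U a n i)
        + t * (U (- a) n (2 ℕ.+ i) + U a n (2 ℕ.+ i) + + 2 * U a n (suc i))
        ≡⟨ cong₂ (λ u v → s * u + t * v) (at-suc i) (at-suc (suc i)) ⟩
      s * 0ℤ + t * 0ℤ
        ≡⟨ vanish s t ⟩
      0ℤ ∎
      where
      s t : ℤ
      s = - a + (1ℤ + + 2 * a * + suc i)
      t = a * + (2 ℕ.+ i)

-- Binomial sums and the identification of `E` with `R`.

binomialTerm : ℤ → ℕ → (ℕ → ℤ) → ℕ → ℤ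
binomialTerm c n r k = + (n C k) * c ^ k * r (n ℕ.∸ k)

private
  vanishing-binomialTerm : ∀ {n k} c x → n ℕ.< k → + (n C k) * c ^ k * x ≡ 0ℤ
  vanishing-binomialTerm {n} {k} c x n<k =
    trans (cong (λ b → + b * c ^ k * x) (k>n⇒nCk≡0 n<k)) (zeroed (c ^ k) x)
    where
    zeroed : ∀ y x → 0ℤ * y * x ≡ 0ℤ
    zeroed = solve-∀

  zero-sum : ∀ n → ∑[ k < n ] 0ℤ ≡ 0ℤ
  zero-sum zero    = refl
  zero-sum (suc n) = trans (ℤ.+-identityˡ _) (zero-sum n)

  sum-*ˡ : ∀ {n} c (f : ℕ → ℤ) → c * ∑[ k < n ] f (toℕ k) ≡ ∑[ k < n ] (c * f (toℕ k))
  sum-*ˡ {zero}  c f = ℤ.*-zeroʳ c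
  sum-*ˡ {suc n} c f = trans (ℤ.*-distribˡ-+ c (f 0) _)
                             (cong (λ s → c * f 0 + s) (sum-*ˡ {n} c (λ k → f (suc k))))

-- The bound `K` is free because terms with k > n vanish: the induction compares sums of lengths K
-- and K + 1, and the pairing of even and odd terms later needs an even length.
binomialTransform≡∑ : ∀ c n r K → n ℕ.< K →
  binomialTransform c n r ≡ ∑[ k < K ] binomialTerm c n r (toℕ k)
binomialTransform≡∑ c zero r (suc K) _ = sym (begin
  1ℤ * 1ℤ * r 0 + ∑[ k < K ] binomialTerm c 0 r (suc (toℕ k))
    ≡⟨ cong₂ _+_ (ℤ.*-identityˡ (r 0))
         (trans
           (sum-cong-≗ {K} (λ k →
             vanishing-binomialTerm {0} {suc (toℕ k)} c (r 0) (ℕ.s≤s ℕ.z≤n)))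
           (zero-sum K)) ⟩
  r 0 + 0ℤ ≡⟨ ℤ.+-identityʳ (r 0) ⟩
  r 0 ∎)
  where open ≡-Reasoning
binomialTransform≡∑ c (suc n) r (suc K) (ℕ.s≤s n<K) = begin
  c * binomialTransform c n r + binomialTransform c n (r ∘ suc)
    ≡⟨ cong₂ (λ s t → c * s + t) (binomialTransform≡∑ c n r K n<K)
             (binomialTransform≡∑ c n (r ∘ suc) (suc K) (ℕ.m<n⇒m<1+n n<K)) ⟩
  c * (∑[ k < K ] f (toℕ k)) + (g 0 + ∑[ k < K ] g (suc (toℕ k)))
    ≡⟨ cong (_+ (g 0 + ∑[ k < K ] g (suc (toℕ k)))) (sum-*ˡ {K} c f) ⟩
  ∑[ k < K ] (c * f (toℕ k)) + (g 0 + ∑[ k < K ] g (suc (toℕ k)))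
    ≡⟨ swap (∑[ k < K ] (c * f (toℕ k))) (g 0) (∑[ k < K ] g (suc (toℕ k))) ⟩
  g 0 + (∑[ k < K ] (c * f (toℕ k)) + ∑[ k < K ] g (suc (toℕ k)))
    ≡⟨ cong (λ s → g 0 + s) (∑-distrib-+ {K} (λ k → c * f (toℕ k)) (λ k → g (suc (toℕ k)))) ⟨
  g 0 + ∑[ k < K ] (c * f (toℕ k) + g (suc (toℕ k)))
    ≡⟨ cong (λ s → g 0 + s) (sum-cong-≗ {K} (λ k → pascal (toℕ k))) ⟩
  g 0 + ∑[ k < K ] binomialTerm c (suc n) r (suc (toℕ k)) ∎
  where
  open ≡-Reasoning
  f g : ℕ → ℤ
  f = binomialTerm c n r
  g = binomialTerm c n (r ∘ suc)
  swap : ∀ x y z → x + (y + z) ≡ y + (x + z)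
  swap = solve-∀
  -- For k ≥ n the two arguments of r differ (∸ truncates), but there n C suc k = 0.
  reindex : ∀ k → g (suc k) ≡ + (n C suc k) * c ^ suc k * r (n ℕ.∸ k)
  reindex k with ℕ.<-≤-connex k n
  ... | inj₁ k<n = cong (λ j → + (n C suc k) * c ^ suc k * r j) (sym (ℕ.+-∸-assoc 1 k<n))
  ... | inj₂ n≤k = trans (vanishing-binomialTerm {n} {suc k} c _ (ℕ.s≤s n≤k))
                         (sym (vanishing-binomialTerm {n} {suc k} c _ (ℕ.s≤s n≤k)))
  merge : ∀ c x y p z → c * (x * p * z) + y * (c * p) * z ≡ (x + y) * (c * p) * z
  merge = solve-∀
  pascal : ∀ k → c * f k + g (suc k) ≡ binomialTerm c (suc n) r (suc k)
  pascal k = begin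
    c * f k + g (suc k)
      ≡⟨ cong (λ s → c * f k + s) (reindex k) ⟩
    c * f k + + (n C suc k) * c ^ suc k * r (n ℕ.∸ k)
      ≡⟨ merge c (+ (n C k)) (+ (n C suc k)) (c ^ k) (r (n ℕ.∸ k)) ⟩
    (+ (n C k) + + (n C suc k)) * c ^ suc k * r (n ℕ.∸ k)
      ≡⟨ cong (λ b → + b * c ^ suc k * r (n ℕ.∸ k)) (nCk+nC[k+1]≡[n+1]C[k+1] n k) ⟩
    binomialTerm c (suc n) r (suc k) ∎

∑-pairs : ∀ L (f : ℕ → ℤ) →
  ∑[ k < L ℕ.* 2 ] f (toℕ k) ≡ ∑[ j < L ] (f (2 ℕ.* toℕ j) + f (suc (2 ℕ.* toℕ j)))
∑-pairs zero    f = refl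
∑-pairs (suc L) f = trans (sym (ℤ.+-assoc (f 0) (f 1) _)) (cong (λ s → f 0 + f 1 + s)
  (trans (∑-pairs L (λ k → f (2 ℕ.+ k)))
         (sum-cong-≗ {L} (λ j → cong (λ k → f k + f (suc k)) (sym (ℕ.*-suc 2 (toℕ j)))))))

n<[1+⌊n/2⌋]*2 : ∀ n → n ℕ.< suc ⌊ n /2⌋ ℕ.* 2
n<[1+⌊n/2⌋]*2 zero          = ℕ.s≤s ℕ.z≤n
n<[1+⌊n/2⌋]*2 (suc zero)    = ℕ.s≤s (ℕ.s≤s ℕ.z≤n)
n<[1+⌊n/2⌋]*2 (suc (suc n)) = ℕ.s≤s (ℕ.s≤s (n<[1+⌊n/2⌋]*2 n))

^-neg-double : ∀ a j → (- a) ^ (2 ℕ.* j) ≡ a ^ (2 ℕ.* j)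
^-neg-double a j = begin
  (- a) ^ (2 ℕ.* j) ≡⟨ ℤ.^-*-assoc (- a) 2 j ⟨
  ((- a) ^ 2) ^ j   ≡⟨ cong (_^ j) (square a) ⟩
  (a ^ 2) ^ j       ≡⟨ ℤ.^-*-assoc a 2 j ⟩
  a ^ (2 ℕ.* j)     ∎
  where
  open ≡-Reasoning
  square : ∀ a → - a * (- a * 1ℤ) ≡ a * (a * 1ℤ)
  square = solve-∀

-- Odd powers of a and - a cancel, even powers agree.
binomialTransform-even : ∀ a n r →
  let S = ∑[ j ≤ ⌊ n /2⌋ ] binomialTerm a n r (2 ℕ.* toℕ j) in
  binomialTransform (- a) n r + binomialTransform a n r ≡ S + S
binomialTransform-even a n r = begin
  binomialTransform (- a) n r + binomialTransform a n r
    ≡⟨ cong₂ _+_ (halves (- a)) (halves a) ⟩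
  ∑[ j < L ] pair (- a) (toℕ j) + ∑[ j < L ] pair a (toℕ j)
    ≡⟨ ∑-distrib-+ {L} (λ j → pair (- a) (toℕ j)) (λ j → pair a (toℕ j)) ⟨
  ∑[ j < L ] (pair (- a) (toℕ j) + pair a (toℕ j))
    ≡⟨ sum-cong-≗ {L} (λ j → cancel-odd (toℕ j)) ⟩
  ∑[ j < L ] (even (toℕ j) + even (toℕ j))
    ≡⟨ ∑-distrib-+ {L} (λ j → even (toℕ j)) (λ j → even (toℕ j)) ⟩
  ∑[ j < L ] even (toℕ j) + ∑[ j < L ] even (toℕ j) ∎
  where
  open ≡-Reasoning
  L : ℕ
  L = suc ⌊ n /2⌋
  pair : ℤ → ℕ → ℤ
  pair c j = binomialTerm c n r (2 ℕ.* j) + binomialTerm c n r (suc (2 ℕ.* j))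
  even : ℕ → ℤ
  even j = binomialTerm a n r (2 ℕ.* j)
  halves : ∀ c → binomialTransform c n r ≡ ∑[ j < L ] pair c (toℕ j)
  halves c = trans (binomialTransform≡∑ c n r (L ℕ.* 2) (n<[1+⌊n/2⌋]*2 n))
                   (∑-pairs L (binomialTerm c n r))
  collect : ∀ a p x y u v →
    (x * p * u + y * (- a * p) * v) + (x * p * u + y * (a * p) * v) ≡ x * p * u + x * p * u
  collect = solve-∀
  cancel-odd : ∀ j → pair (- a) j + pair a j ≡ even j + even j
  cancel-odd j rewrite ^-neg-double a j =
    collect a (a ^ (2 ℕ.* j)) (+ (n C (2 ℕ.* j))) (+ (n C suc (2 ℕ.* j)))
            (r (n ℕ.∸ 2 ℕ.* j)) (r (n ℕ.∸ suc (2 ℕ.* j)))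

R-recurrence : ∀ a n →
  ∑[ j ≤ ⌊ n /2⌋ ] binomialTerm a n (λ k → R a k 0) (2 ℕ.* toℕ j) ≡ (1ℤ - a) ^ n
R-recurrence a n = ℤ.*-cancelˡ-≡ (+ 2) _ _ (begin
  + 2 * S            ≡⟨ double S ⟩
  S + S              ≡⟨ binomialTransform-even a n (λ k → R a k 0) ⟨
  U a (- a) n 0 + U a a n 0 ≡⟨ proj₁ (U-reflect a n) ⟩
  + 2 * (1ℤ - a) ^ n ∎)
  where
  open ≡-Reasoning
  S : ℤ
  S = ∑[ j ≤ ⌊ n /2⌋ ] binomialTerm a n (λ k → R a k 0) (2 ℕ.* toℕ j)
  double : ∀ x → + 2 * x ≡ x + x
  double = solve-∀

-- Both sequences satisfy the same recurrence, in which the j = 0 term has coefficient 1, so it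
-- determines them.
E≡R : ∀ a n → E a n ≡ R a n 0
E≡R a = <-rec (λ n → E a n ≡ R a n 0) λ n ih → begin
  E a n
    ≡⟨ E-unfold a n ⟩
  (1ℤ - a) ^ n - ∑[ i < ⌊ n /2⌋ ] (coeff n (toℕ i) * E a (n ℕ.∸ 2 ℕ.* suc (toℕ i)))
    ≡⟨ cong₂ _-_ (sym (R-recurrence a n))
         (sum-cong-≗ {⌊ n /2⌋} (λ i → cong (coeff n (toℕ i) *_) (ih (n∸2j<n n i)))) ⟩
  -- The sum in `R-recurrence` unfolds to its j = 0 term plus `tail n`.
  (1ℤ * R a n 0 + tail n) - tail n
    ≡⟨ cancel (R a n 0) (tail n) ⟩
  R a n 0 ∎
  where
  open ≡-Reasoning
  coeff : ℕ → ℕ → ℤ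
  coeff n i = + (n C (2 ℕ.* suc i)) * a ^ (2 ℕ.* suc i)
  tail : ℕ → ℤ
  tail n = ∑[ i < ⌊ n /2⌋ ] binomialTerm a n (λ k → R a k 0) (2 ℕ.* suc (toℕ i))
  cancel : ∀ x y → (1ℤ * x + y) - y ≡ x
  cancel = solve-∀

-- Divisibility by powers of 2.

infix 9 2^_

2^_ : ℕ → ℤ
2^ e = (+ 2) ^ e

∣ˢ-resp-≡ : ∀ {d x y} → x ≡ y → d ∣ˢ x → d ∣ˢ y
∣ˢ-resp-≡ refl d∣x = d∣x

2^-mono-∣ : ∀ {d e} → d ℕ.≤ e → 2^ d ∣ˢ 2^ e
2^-mono-∣ {d} {e} d≤e = divides (2^ (e ℕ.∸ d))
  (trans (cong 2^_ (sym (ℕ.m∸n+n≡m d≤e))) (ℤ.^-distribˡ-+-* (+ 2) (e ℕ.∸ d) d))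

2^-weaken : ∀ {d e x} → d ℕ.≤ e → 2^ e ∣ˢ x → 2^ d ∣ˢ x
2^-weaken d≤e = Signed.∣-trans (2^-mono-∣ d≤e)

2^-*-∣ : ∀ d e {x y} → 2^ d ∣ˢ x → 2^ e ∣ˢ y → 2^ (d ℕ.+ e) ∣ˢ x * y
2^-*-∣ d e (divides p refl) (divides q refl) = divides (p * q)
  (trans (regroup p q (2^ d) (2^ e)) (cong (p * q *_) (sym (ℤ.^-distribˡ-+-* (+ 2) d e))))
  where
  regroup : ∀ p q u v → p * u * (q * v) ≡ p * q * (u * v)
  regroup = solve-∀

-- The part of the bracket in the theorem that does not depend on m.
ψ : ℤ → ℤ → ℤ
ψ a b =
    (+ 17 * a ^ 7 + + 162 * a ^ 5 + + 153 * a ^ 3 + + 64 * a ^ 2 + + 180 * a + + 192) * b ^ 2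
  - (+ 102 * a ^ 7 + + 216 * a ^ 5 + + 386 * a ^ 3 - + 704 * a) * b
  - (+ 211 * a ^ 7 - + 10 * a ^ 5 - + 32 * a ^ 4 + + 66 * a ^ 3 - + 267 * a - + 224)

-- Smooth functions and extrapolation.

module Smoothness {A : Set} (next : A → A) where

  Δ : (A → ℤ) → A → ℤ
  Δ F x = F (next x) - F x

  -- For j ≤ r, the j-th difference of F is divisible by 2^(e+j).
  data Smooth : ℕ → ℕ → (A → ℤ) → Set where
    base : ∀ {e F} → (∀ x → 2^ e ∣ˢ F x) → Smooth zero e F
    step : ∀ {r e F} → (∀ x → 2^ e ∣ˢ F x) → Smooth r (suc e) (Δ F) → Smooth (suc r) e F

  Smooth∞ : ℕ → (A → ℤ) → Set
  Smooth∞ e F = ∀ r → Smooth r e F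

  smooth-∣ : ∀ {r e F} → Smooth r e F → ∀ x → 2^ e ∣ˢ F x
  smooth-∣ (base f)   = f
  smooth-∣ (step f _) = f

  smooth-Δ : ∀ {r e F} → Smooth (suc r) e F → Smooth r (suc e) (Δ F)
  smooth-Δ (step _ F′) = F′

  smooth-init : ∀ {r e F} → Smooth (suc r) e F → Smooth r e F
  smooth-init {zero}  (step f _)  = base f
  smooth-init {suc r} (step f F′) = step f (smooth-init F′)

  smooth-resp-≗ : ∀ {r e F G} → (∀ x → F x ≡ G x) → Smooth r e F → Smooth r e G
  smooth-resp-≗ eq (base f) = base (λ x → ∣ˢ-resp-≡ (eq x) (f x))
  smooth-resp-≗ eq (step f F′) = step (λ x → ∣ˢ-resp-≡ (eq x) (f x))
    (smooth-resp-≗ (λ x → cong₂ _-_ (eq (next x)) (eq x)) F′)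

  smooth-weaken : ∀ {r d e F} → d ℕ.≤ e → Smooth r e F → Smooth r d F
  smooth-weaken d≤e (base f)    = base (λ x → 2^-weaken d≤e (f x))
  smooth-weaken d≤e (step f F′) =
    step (λ x → 2^-weaken d≤e (f x)) (smooth-weaken (ℕ.s≤s d≤e) F′)

  smooth-const : ∀ {r e c} → 2^ e ∣ˢ c → Smooth r e (λ _ → c)
  smooth-const {zero}          e∣c = base (λ _ → e∣c)
  smooth-const {suc r} {c = c} e∣c = step (λ _ → e∣c)
    (smooth-resp-≗ (λ _ → sym (ℤ.+-inverseʳ c)) (smooth-const (divides 0ℤ refl)))

  smooth-const₀ : ∀ {r} c → Smooth r 0 (λ _ → c)
  smooth-const₀ c = smooth-const (divides c (sym (ℤ.*-identityʳ c)))

  smooth-+ : ∀ {r e F G} → Smooth r e F → Smooth r e G → Smooth r e (λ x → F x + G x)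
  smooth-+ (base f) (base g) = base (λ x → ∣m∣n⇒∣m+n (f x) (g x))
  smooth-+ {F = F} {G} (step f F′) (step g G′) = step (λ x → ∣m∣n⇒∣m+n (f x) (g x))
    (smooth-resp-≗ (λ x → regroup (F (next x)) (F x) (G (next x)) (G x)) (smooth-+ F′ G′))
    where
    regroup : ∀ f′ f g′ g → (f′ - f) + (g′ - g) ≡ (f′ + g′) - (f + g)
    regroup = solve-∀

  smooth-neg : ∀ {r e F} → Smooth r e F → Smooth r e (λ x → - F x)
  smooth-neg (base f) = base (λ x → ∣m⇒∣-m (f x))
  smooth-neg {F = F} (step f F′) = step (λ x → ∣m⇒∣-m (f x))
    (smooth-resp-≗ (λ x → regroup (F (next x)) (F x)) (smooth-neg F′))
    where
    regroup : ∀ f′ f → - (f′ - f) ≡ - f′ - - f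
    regroup = solve-∀

  smooth-sub : ∀ {r e F G} → Smooth r e F → Smooth r e G → Smooth r e (λ x → F x - G x)
  smooth-sub F G = smooth-+ F (smooth-neg G)

  -- Leibniz rule Δ(FG) = ΔF ΔG + ΔF G + F ΔG; the first summand has a factor 2 to spare.
  smooth-* : ∀ {r d e F G} → Smooth r d F → Smooth r e G → Smooth r (d ℕ.+ e) (λ x → F x * G x)
  smooth-* {zero} {d} {e} (base f) (base g) = base (λ x → 2^-*-∣ d e (f x) (g x))
  smooth-* {suc r} {d} {e} {F} {G} sF@(step f F′) sG@(step g G′) =
    step (λ x → 2^-*-∣ d e (f x) (g x))
      (smooth-resp-≗ (λ x → leibniz (F (next x)) (F x) (G (next x)) (G x))
        (smooth-+ (smooth-weaken (ℕ.s≤s (ℕ.+-monoʳ-≤ d (ℕ.n≤1+n e))) (smooth-* F′ G′))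
          (smooth-+ (smooth-* F′ (smooth-init sG))
                    (subst (λ n → Smooth r n (λ x → F x * Δ G x)) (ℕ.+-suc d e)
                           (smooth-* (smooth-init sF) G′)))))
    where
    leibniz : ∀ f′ f g′ g →
      (f′ - f) * (g′ - g) + ((f′ - f) * g + f * (g′ - g)) ≡ f′ * g′ - f * g
    leibniz = solve-∀

  smooth-^ : ∀ {r F} → Smooth r 0 F → ∀ n → Smooth r 0 (λ x → F x ^ n)
  smooth-^ sF zero    = smooth-const₀ 1ℤ
  smooth-^ sF (suc n) = smooth-* sF (smooth-^ sF n)

  -- This is where odd arguments enter: running through the odd numbers has first difference 2 and
  -- all higher differences 0.
  smooth-Δ≡2 : ∀ {r F} → (∀ x → Δ F x ≡ + 2) → Smooth r 0 F
  smooth-Δ≡2 {zero}  {F} eq = base (λ x → divides (F x) (sym (ℤ.*-identityʳ (F x))))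
  smooth-Δ≡2 {suc r} {F} eq = step (λ x → divides (F x) (sym (ℤ.*-identityʳ (F x))))
    (smooth-resp-≗ (sym ∘ eq) (smooth-const (divides 1ℤ refl)))

  ψ-smooth : ∀ {r F G} → Smooth r 0 F → Smooth r 0 G → Smooth r 0 (λ x → ψ (F x) (G x))
  ψ-smooth {r} {F} sF sG =
    smooth-sub
      (smooth-sub
        (smooth-*
          (smooth-+ (smooth-+ (smooth-+ (smooth-+ (smooth-+ (monomial 17 7) (monomial 162 5))
            (monomial 153 3)) (monomial 64 2)) (linear 180)) (smooth-const₀ (+ 192)))
          (smooth-^ sG 2))
        (smooth-*
          (smooth-sub (smooth-+ (smooth-+ (monomial 102 7) (monomial 216 5)) (monomial 386 3))
            (linear 704))
          sG))
      (smooth-sub (smooth-sub (smooth-+ (smooth-sub (smooth-sub (monomial 211 7) (monomial 10 5))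
        (monomial 32 4)) (monomial 66 3)) (linear 267)) (smooth-const₀ (+ 224)))
    where
    monomial : ∀ c n → Smooth r 0 (λ x → + c * F x ^ n)
    monomial c n = smooth-* (smooth-const₀ (+ c)) (smooth-^ sF n)
    linear : ∀ c → Smooth r 0 (λ x → + c * F x)
    linear c = smooth-* (smooth-const₀ (+ c)) sF

  -- `connected` abstracts induction along `next` in both directions, so that one argument serves
  -- the index in ℕ and the parameter in ℤ.
  module Extrapolation
    (point : ℕ → A) (point-suc : ∀ i → point (suc i) ≡ next (point i))
    (connected : (Q : A → Set) → Q (point 0) →
                 (∀ x → Q x → Q (next x)) → (∀ x → Q (next x) → Q x) → ∀ x → Q x) where

    -- Induction on r. Differences of the given values are r - 1 values of Δ F, so the induction
    -- hypothesis makes Δ F divisible everywhere; then a single divisible value of F spreads to all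
    -- of them.
    extrapolate : ∀ {r e F} → Smooth r e F →
      (∀ {i} → i ℕ.< r → 2^ (r ℕ.+ e) ∣ˢ F (point i)) → ∀ x → 2^ (r ℕ.+ e) ∣ˢ F x
    extrapolate (base f) _ = f
    extrapolate {suc r} {e} {F} (step _ F′) at-points =
      connected (λ x → d ∣ˢ F x) (at-points (ℕ.s≤s ℕ.z≤n))
        (λ x d∣Fx → ∣ˢ-resp-≡ (up (F (next x)) (F x)) (∣m∣n⇒∣m+n (d∣Δ x) d∣Fx))
        (λ x d∣Fx′ → ∣ˢ-resp-≡ (down (F (next x)) (F x)) (∣m∣n⇒∣m-n d∣Fx′ (d∣Δ x)))
      where
      d : ℤ
      d = 2^ (suc r ℕ.+ e)
      up : ∀ u v → (u - v) + v ≡ u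
      up = solve-∀
      down : ∀ u v → u - (u - v) ≡ v
      down = solve-∀
      Δ-at-points : ∀ {i} → i ℕ.< r → d ∣ˢ Δ F (point i)
      Δ-at-points {i} i<r = ∣m∣n⇒∣m-n
        (∣ˢ-resp-≡ (cong F (point-suc i)) (at-points (ℕ.s≤s i<r)))
        (at-points (ℕ.m<n⇒m<1+n i<r))
      d∣Δ : ∀ x → d ∣ˢ Δ F x
      d∣Δ x = subst (λ n → 2^ n ∣ˢ Δ F x) (ℕ.+-suc r e)
        (extrapolate F′
          (λ {i} i<r → subst (λ n → 2^ n ∣ˢ Δ F (point i)) (sym (ℕ.+-suc r e)) (Δ-at-points i<r))
          x)

-- Connectedness of ℕ and ℤ, and smoothness in the parameter.

ℕ-connected : (Q : ℕ → Set) → Q 0 →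
  (∀ x → Q x → Q (suc x)) → (∀ x → Q (suc x) → Q x) → ∀ x → Q x
ℕ-connected Q q₀ up down zero    = q₀
ℕ-connected Q q₀ up down (suc x) = up x (ℕ-connected Q q₀ up down x)

ℤ-connected : (Q : ℤ → Set) → Q 0ℤ →
  (∀ x → Q x → Q (sucℤ x)) → (∀ x → Q (sucℤ x) → Q x) → ∀ x → Q x
ℤ-connected Q q₀ up down (+ zero)     = q₀
ℤ-connected Q q₀ up down (+ suc n)    = up (+ n) (ℤ-connected Q q₀ up down (+ n))
ℤ-connected Q q₀ up down -[1+ zero ]  = down -[1+ zero ] q₀
ℤ-connected Q q₀ up down -[1+ suc n ] = down -[1+ suc n ] (ℤ-connected Q q₀ up down -[1+ n ])

module ℤ-Smoothness where
  open Smoothness sucℤ public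
  open Extrapolation +_ (λ _ → refl) ℤ-connected public

odd : ℤ → ℤ
odd j = 1ℤ + + 2 * j

module _ where
  open ℤ-Smoothness

  odd-smooth : ∀ {r} → Smooth r 0 odd
  odd-smooth = smooth-Δ≡2 gap
    where
    gap : ∀ j → (1ℤ + + 2 * (1ℤ + j)) - (1ℤ + + 2 * j) ≡ + 2
    gap = solve-∀

  -- `R a n i` is a polynomial in a with integer coefficients, and smooth functions form a ring.
  R-smooth-param : ∀ {r} n i → Smooth r 0 (λ j → R (odd j) n i)
  R-smooth-param zero    i = smooth-const₀ ((- 1ℤ) ^ i)
  R-smooth-param (suc n) i = smooth-+
    (smooth-* (smooth-+ (smooth-const₀ 1ℤ)
                        (smooth-* (smooth-* (smooth-const₀ (+ 2)) odd-smooth) (smooth-const₀ (+ i))))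
              (R-smooth-param n i))
    (smooth-* (smooth-* odd-smooth (smooth-const₀ (+ suc i))) (R-smooth-param n (suc i)))

-- Tabulated values and the finite checks.

oddPart : ℤ → ℕ → ℤ
oddPart a β = R a (suc (β ℕ.* 2)) 0

Δ[_] : ℕ → (ℕ → ℤ) → ℕ → ℤ
Δ[ h ] F β = F (h ℕ.+ β) - F β

-- Computes a row of `R` from the previous one, as direct evaluation of `R` would branch
-- exponentially. The last entry is dropped for want of a right neighbour, so k initial signs yield
-- the values for n < k.
advance : ℤ → ℕ → List ℤ → List ℤ
advance a i []           = []
advance a i (_ ∷ [])     = []
advance a i (x ∷ y ∷ ys) = ((1ℤ + + 2 * a * + i) * x + a * + suc i * y) ∷ advance a (suc i) (y ∷ ys)

heads : ℤ → ℕ → List ℤ → List ℤ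
heads a zero    row      = []
heads a (suc k) []       = []
heads a (suc k) (x ∷ xs) = x ∷ heads a k (advance a 0 (x ∷ xs))

signs : ℕ → ℤ → List ℤ
signs zero    s = []
signs (suc k) s = s ∷ signs k (- 1ℤ * s)

table : ℕ → ℤ → List ℤ
table k a = heads a k (signs k 1ℤ)

ListsFrom : (ℕ → ℤ) → ℕ → List ℤ → Set
ListsFrom f i []       = ⊤
ListsFrom f i (x ∷ xs) = x ≡ f i × ListsFrom f (suc i) xs

advance-lists : ∀ a n i xs → ListsFrom (R a n) i xs → ListsFrom (R a (suc n)) i (advance a i xs)
advance-lists a n i []           _                = tt
advance-lists a n i (_ ∷ [])     _                = tt
advance-lists a n i (_ ∷ y ∷ ys) (refl , refl , p) =
  refl , advance-lists a n (suc i) (y ∷ ys) (refl , p)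

heads-lists : ∀ a k n xs → ListsFrom (R a n) 0 xs → ListsFrom (λ n → R a n 0) n (heads a k xs)
heads-lists a zero    n xs       _          = tt
heads-lists a (suc k) n []       _          = tt
heads-lists a (suc k) n (x ∷ xs) p@(eq , _) =
  eq , heads-lists a k (suc n) (advance a 0 (x ∷ xs)) (advance-lists a n 0 (x ∷ xs) p)

signs-lists : ∀ a k i → ListsFrom (R a 0) i (signs k ((- 1ℤ) ^ i))
signs-lists a zero    i = tt
signs-lists a (suc k) i = refl , signs-lists a k (suc i)

-- The value past the end of the list is the one being tabulated,
-- so that lookup-correct needs no bound on the index.
lookup : List ℤ → (ℕ → ℤ) → ℕ → ℕ → ℤ
lookup []       f i n       = f (n ℕ.+ i)
lookup (x ∷ xs) f i zero    = x
lookup (x ∷ xs) f i (suc n) = lookup xs f (suc i) n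

lookup-correct : ∀ xs f i → ListsFrom f i xs → ∀ n → lookup xs f i n ≡ f (n ℕ.+ i)
lookup-correct []       f i _        n       = refl
lookup-correct (x ∷ xs) f i (eq , _) zero    = eq
lookup-correct (x ∷ xs) f i (_ , p)  (suc n) =
  trans (lookup-correct xs f (suc i) p n) (cong f (ℕ.+-suc n i))

tabulated : ℤ → List ℤ → ℕ → ℤ
tabulated a xs β = lookup xs (λ n → R a n 0) 0 (suc (β ℕ.* 2))

tabulated-correct : ∀ k a β → tabulated a (table k a) β ≡ oddPart a β
tabulated-correct k a β = trans
  (lookup-correct (table k a) (λ n → R a n 0) 0
    (heads-lists a k 0 (signs k 1ℤ) (signs-lists a k 0)) (suc (β ℕ.* 2)))
  (cong (λ n → R a n 0) (ℕ.+-identityʳ (suc (β ℕ.* 2))))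

-- Here Δ[ 16 ] is the step 32 = 2⁵ in n = 1 + 2β.
firstDefect : ℤ → (ℕ → ℤ) → ℕ → ℤ
firstDefect a F β =
  Δ[ 16 ] F β - 2^ 5 * (ψ a (+ suc (β ℕ.* 2)) + 2^ 6 * (a ^ 2 - + 1))

-- The subtracted term is w² (a² - 1) with w = 2^(m+1) at m = 5, the value that Δ_{2h} = Δ_h² + 2
-- Δ_h forces on comparing the claims for m and m + 1.
secondDefect : ℤ → (ℕ → ℤ) → ℕ → ℤ
secondDefect a F β = Δ[ 16 ] (Δ[ 16 ] F) β - 2^ 6 * 2^ 6 * (a ^ 2 - + 1)

-- The list is an argument, so that evaluation shares one table between all the β.
firstDefect? : ∀ a xs → Dec (∀ {β} → β ℕ.< 10 → 2^ 15 ∣ˢ firstDefect a (tabulated a xs) β)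
firstDefect? a xs = ℕ.allUpTo? (λ β → 2^ 15 ∣ˢ? firstDefect a (tabulated a xs) β) 10

secondDefect? : ∀ a xs → Dec (∀ {β} → β ℕ.< 6 → 2^ 16 ∣ˢ secondDefect a (tabulated a xs) β)
secondDefect? a xs = ℕ.allUpTo? (λ β → 2^ 16 ∣ˢ? secondDefect a (tabulated a xs) β) 6

-- Decided by evaluation. Extrapolation to modulus 2^15 takes 15 parameters, and 10 indices since
-- 2^5 divides the defect anyway. The largest n is 1 + 2 (16 + 9) = 51, hence 52 entries.
firstDefect-table : ∀ {j} → j ℕ.< 15 → ∀ {β} → β ℕ.< 10 →
  2^ 15 ∣ˢ firstDefect (odd (+ j)) (tabulated (odd (+ j)) (table 52 (odd (+ j)))) β
firstDefect-table = toWitness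
  {a? = ℕ.allUpTo? (λ j → firstDefect? (odd (+ j)) (table 52 (odd (+ j)))) 15} tt

-- Here 2^10 comes for free, leaving 6 indices; the largest n is 1 + 2 (32 + 5) = 75.
secondDefect-table : ∀ {j} → j ℕ.< 16 → ∀ {β} → β ℕ.< 6 →
  2^ 16 ∣ˢ secondDefect (odd (+ j)) (tabulated (odd (+ j)) (table 76 (odd (+ j)))) β
secondDefect-table = toWitness
  {a? = ℕ.allUpTo? (λ j → secondDefect? (odd (+ j)) (table 76 (odd (+ j)))) 16} tt

-- Extrapolation of the defects to all odd parameters.

firstDefect-cong : ∀ a {F G} → (∀ β → F β ≡ G β) → ∀ β → firstDefect a F β ≡ firstDefect a G β
firstDefect-cong a eq β = cong (_- 2^ 5 * (ψ a (+ suc (β ℕ.* 2)) + 2^ 6 * (a ^ 2 - + 1)))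
  (cong₂ _-_ (eq (16 ℕ.+ β)) (eq β))

secondDefect-cong : ∀ a {F G} → (∀ β → F β ≡ G β) → ∀ β → secondDefect a F β ≡ secondDefect a G β
secondDefect-cong a eq β = cong (_- 2^ 6 * 2^ 6 * (a ^ 2 - + 1))
  (cong₂ _-_ (cong₂ _-_ (eq (16 ℕ.+ (16 ℕ.+ β))) (eq (16 ℕ.+ β)))
             (cong₂ _-_ (eq (16 ℕ.+ β)) (eq β)))

module _ where
  open ℤ-Smoothness

  private
    oddPart-smooth-param : ∀ {r} β → Smooth r 0 (λ j → oddPart (odd j) β)
    oddPart-smooth-param β = R-smooth-param (suc (β ℕ.* 2)) 0

    square-1-smooth : ∀ {r} → Smooth r 0 (λ j → odd j ^ 2 - + 1)
    square-1-smooth = smooth-sub (smooth-^ odd-smooth 2) (smooth-const₀ (+ 1))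

    firstDefect-smooth : ∀ {r} β → Smooth r 0 (λ j → firstDefect (odd j) (oddPart (odd j)) β)
    firstDefect-smooth {r} β =
      smooth-sub {F = λ j → Δ[ 16 ] (oddPart (odd j)) β}
                 {G = λ j → 2^ 5 * (ψ (odd j) (+ suc (β ℕ.* 2)) + 2^ 6 * (odd j ^ 2 - + 1))}
        (smooth-sub (oddPart-smooth-param (16 ℕ.+ β)) (oddPart-smooth-param β))
        (smooth-* (smooth-const₀ (2^ 5))
          (smooth-+ (ψ-smooth odd-smooth (smooth-const₀ (+ suc (β ℕ.* 2))))
                    (smooth-* (smooth-const₀ (2^ 6)) square-1-smooth)))

    secondDefect-smooth : ∀ {r} β → Smooth r 0 (λ j → secondDefect (odd j) (oddPart (odd j)) β)
    secondDefect-smooth β =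
      smooth-sub {F = λ j → Δ[ 16 ] (Δ[ 16 ] (oddPart (odd j))) β}
                 {G = λ j → 2^ 6 * 2^ 6 * (odd j ^ 2 - + 1)}
        (smooth-sub
          (smooth-sub (oddPart-smooth-param (16 ℕ.+ (16 ℕ.+ β))) (oddPart-smooth-param (16 ℕ.+ β)))
          (smooth-sub (oddPart-smooth-param (16 ℕ.+ β)) (oddPart-smooth-param β)))
        (smooth-* (smooth-const₀ (2^ 6 * 2^ 6)) square-1-smooth)

    firstDefect-oddPart : ∀ d k a β → d ∣ˢ firstDefect a (tabulated a (table k a)) β →
      d ∣ˢ firstDefect a (oddPart a) β
    firstDefect-oddPart d k a β = subst (d ∣ˢ_)
      (firstDefect-cong a {tabulated a (table k a)} {oddPart a} (tabulated-correct k a) β)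

    secondDefect-oddPart : ∀ d k a β → d ∣ˢ secondDefect a (tabulated a (table k a)) β →
      d ∣ˢ secondDefect a (oddPart a) β
    secondDefect-oddPart d k a β = subst (d ∣ˢ_)
      (secondDefect-cong a {tabulated a (table k a)} {oddPart a} (tabulated-correct k a) β)

  firstDefect-at : ∀ {β} → β ℕ.< 10 → ∀ j → 2^ 15 ∣ˢ firstDefect (odd j) (oddPart (odd j)) β
  firstDefect-at {β} β<10 = extrapolate {15} {0} {λ j → firstDefect (odd j) (oddPart (odd j)) β}
    (firstDefect-smooth {15} β)
    (λ {j} j<15 → firstDefect-oddPart (2^ 15) 52 (odd (+ j)) β (firstDefect-table {j} j<15 {β} β<10))

  secondDefect-at : ∀ {β} → β ℕ.< 6 → ∀ j → 2^ 16 ∣ˢ secondDefect (odd j) (oddPart (odd j)) β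
  secondDefect-at {β} β<6 = extrapolate {16} {0} {λ j → secondDefect (odd j) (oddPart (odd j)) β}
    (secondDefect-smooth {16} β)
    (λ {j} j<16 → secondDefect-oddPart (2^ 16) 76 (odd (+ j)) β (secondDefect-table {j} j<16 {β} β<6))

-- Smoothness in the index.

open Smoothness suc
open Extrapolation (λ i → i) (λ _ → refl) ℕ-connected

-- The coefficients do not involve n, so differences in n satisfy the recursion again and the
-- divisibility argument can be iterated.
SatisfiesR : ℤ → (ℕ → ℕ → ℤ) → Set
SatisfiesR a Q = ∀ n i → Q (suc n) i ≡ (1ℤ + + 2 * a * + i) * Q n i + a * + suc i * Q n (suc i)

2∣i*[1+i] : ∀ i → + 2 ∣ˢ + i * + suc i
2∣i*[1+i] zero    = divides 0ℤ refl
2∣i*[1+i] (suc i) = ∣ˢ-resp-≡ (regroup (+ i))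
  (∣m∣n⇒∣m+n (2∣i*[1+i] i) (divides (+ suc i) refl))
  where
  regroup : ∀ x → x * (1ℤ + x) + (1ℤ + x) * + 2 ≡ (1ℤ + x) * (1ℤ + (1ℤ + x))
  regroup = solve-∀

module _ {a : ℤ} where

  twoStepΔ : (ℕ → ℕ → ℤ) → ℕ → ℕ → ℤ
  twoStepΔ Q n i = Q (2 ℕ.+ n) i - Q n i

  satisfiesR-Δ : ∀ {Q} → SatisfiesR a Q → SatisfiesR a (twoStepΔ Q)
  satisfiesR-Δ {Q} sat n i = trans (cong₂ _-_ (sat (2 ℕ.+ n) i) (sat n i))
    (regroup (1ℤ + + 2 * a * + i) (a * + suc i)
             (Q (2 ℕ.+ n) i) (Q (2 ℕ.+ n) (suc i)) (Q n i) (Q n (suc i)))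
    where
    regroup : ∀ x y p′ q′ p q →
      (x * p′ + y * q′) - (x * p + y * q) ≡ x * (p′ - p) + y * (q′ - q)
    regroup = solve-∀

  -- Multiplication by X² - 1: applying the recursion twice, the coefficients of `Q n i` and
  -- `Q n (suc i)` are visibly even, and that of `Q n (2 + i)` contains the product (i + 1)(i + 2).
  twoStepΔ-∣ : ∀ {Q e} → SatisfiesR a Q → (∀ n i → 2^ e ∣ˢ Q n i) →
    ∀ n i → 2^ suc e ∣ˢ twoStepΔ Q n i
  twoStepΔ-∣ {Q} {e} sat e∣Q n i with 2∣i*[1+i] (suc i)
  ... | divides t eq = ∣ˢ-resp-≡ (sym expansion)
    (2^-*-∣ 1 e (divides 1ℤ refl)
      (∣m∣n⇒∣m+n (∣m∣n⇒∣m+n (∣n⇒∣m*n c₀ (e∣Q n i)) (∣n⇒∣m*n c₁ (e∣Q n (suc i))))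
                 (∣n⇒∣m*n (a * a * t) (e∣Q n (2 ℕ.+ i)))))
    where
    open ≡-Reasoning
    c₀ c₁ q₀ q₁ q₂ : ℤ
    c₀ = + 2 * a * + i * (1ℤ + a * + i)
    c₁ = a * + suc i * (1ℤ + a + + 2 * a * + i)
    q₀ = Q n i
    q₁ = Q n (suc i)
    q₂ = Q n (2 ℕ.+ i)
    square : ∀ a x q₀ q₁ q₂ →
      (1ℤ + + 2 * a * x) * ((1ℤ + + 2 * a * x) * q₀ + a * (1ℤ + x) * q₁)
        + a * (1ℤ + x) * ((1ℤ + + 2 * a * (1ℤ + x)) * q₁ + a * (1ℤ + (1ℤ + x)) * q₂) - q₀
        ≡ + 2 * (+ 2 * a * x * (1ℤ + a * x) * q₀ + a * (1ℤ + x) * (1ℤ + a + + 2 * a * x) * q₁)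
          + a * a * ((1ℤ + x) * (1ℤ + (1ℤ + x))) * q₂
    square = solve-∀
    halve : ∀ s a t q₂ → + 2 * s + a * a * (t * + 2) * q₂ ≡ + 2 * (s + a * a * t * q₂)
    halve = solve-∀
    expansion : twoStepΔ Q n i ≡ + 2 * (c₀ * q₀ + c₁ * q₁ + a * a * t * q₂)
    expansion = begin
      twoStepΔ Q n i
        ≡⟨ cong (_- q₀) (trans (sat (suc n) i)
             (cong₂ (λ u v → (1ℤ + + 2 * a * + i) * u + a * + suc i * v)
                    (sat n i) (sat n (suc i)))) ⟩
      _ ≡⟨ square a (+ i) q₀ q₁ q₂ ⟩
      + 2 * (c₀ * q₀ + c₁ * q₁) + a * a * (+ suc i * + (2 ℕ.+ i)) * q₂
        ≡⟨ cong (λ w → + 2 * (c₀ * q₀ + c₁ * q₁) + a * a * w * q₂) eq ⟩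
      + 2 * (c₀ * q₀ + c₁ * q₁) + a * a * (t * + 2) * q₂
        ≡⟨ halve (c₀ * q₀ + c₁ * q₁) a t q₂ ⟩
      + 2 * (c₀ * q₀ + c₁ * q₁ + a * a * t * q₂) ∎

  satisfiesR-smooth : ∀ {Q e} → SatisfiesR a Q → (∀ n i → 2^ e ∣ˢ Q n i) →
    Smooth∞ e (λ β → Q (suc (β ℕ.* 2)) 0)
  satisfiesR-smooth sat e∣Q zero    = base (λ β → e∣Q (suc (β ℕ.* 2)) 0)
  satisfiesR-smooth {Q} {e} sat e∣Q (suc r) = step (λ β → e∣Q (suc (β ℕ.* 2)) 0)
    (satisfiesR-smooth {twoStepΔ Q} {suc e} (satisfiesR-Δ {Q} sat) (twoStepΔ-∣ {Q} {e} sat e∣Q) r)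

oddPart-smooth : ∀ a → Smooth∞ 0 (oddPart a)
oddPart-smooth a = satisfiesR-smooth {a} {R a} {0} (λ _ _ → refl)
  (λ n i → divides (R a n i) (sym (ℤ.*-identityʳ (R a n i))))

-- Differences with step a power of 2.

2^[1+s]+β : ∀ s β → 2 ℕ.^ suc s ℕ.+ β ≡ 2 ℕ.^ s ℕ.+ (2 ℕ.^ s ℕ.+ β)
2^[1+s]+β s β = trans (cong (λ h → (2 ℕ.^ s ℕ.+ h) ℕ.+ β) (ℕ.+-identityʳ (2 ℕ.^ s)))
                      (ℕ.+-assoc (2 ℕ.^ s) (2 ℕ.^ s) β)

Δ-double : ∀ s F β →
  Δ[ 2 ℕ.^ s ] (Δ[ 2 ℕ.^ s ] F) β + + 2 * Δ[ 2 ℕ.^ s ] F β ≡ Δ[ 2 ℕ.^ suc s ] F β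
Δ-double s F β rewrite 2^[1+s]+β s β = regroup (F (h ℕ.+ (h ℕ.+ β))) (F (h ℕ.+ β)) (F β)
  where
  h : ℕ
  h = 2 ℕ.^ s
  regroup : ∀ x y z → ((x - y) - (y - z)) + + 2 * (y - z) ≡ x - z
  regroup = solve-∀

-- The operator identity (D² + 2 D)² = 4 D² + 4 D³ + D⁴.
ΔΔ-double : ∀ s F β → let D = Δ[ 2 ℕ.^ s ] ; q = D (D F) in
  Δ[ 2 ℕ.^ suc s ] (Δ[ 2 ℕ.^ suc s ] F) β ≡ + 4 * q β + (+ 4 * D q β + D (D q) β)
ΔΔ-double s F β
  rewrite 2^[1+s]+β s β | 2^[1+s]+β s (2 ℕ.^ s ℕ.+ (2 ℕ.^ s ℕ.+ β)) =
  regroup (F (h ℕ.+ (h ℕ.+ (h ℕ.+ (h ℕ.+ β))))) (F (h ℕ.+ (h ℕ.+ (h ℕ.+ β))))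
          (F (h ℕ.+ (h ℕ.+ β))) (F (h ℕ.+ β)) (F β)
  where
  h : ℕ
  h = 2 ℕ.^ s
  regroup : ∀ v w x y z →
    (v - x) - (x - z) ≡
      + 4 * ((x - y) - (y - z))
        + (+ 4 * (((w - x) - (x - y)) - ((x - y) - (y - z)))
          + ((((v - w) - (w - x)) - ((w - x) - (x - y)))
             - (((w - x) - (x - y)) - ((x - y) - (y - z)))))
  regroup = solve-∀

-- In Δ_{2h} = Δ_h² + 2 Δ_h each summand gains at least one factor 2 over Δ_h.
Δ[2^]-smooth : ∀ s {e F} → Smooth∞ e F → Smooth∞ (suc s ℕ.+ e) (Δ[ 2 ℕ.^ s ] F)
Δ[2^]-smooth zero            sF r = smooth-Δ (sF (suc r))
Δ[2^]-smooth (suc s) {e} {F} sF r = smooth-resp-≗ (Δ-double s F)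
  (smooth-+
    (smooth-weaken (ℕ.+-monoˡ-≤ (suc s ℕ.+ e) (ℕ.s≤s (ℕ.z≤n {s})))
                   (Δ[2^]-smooth s (Δ[2^]-smooth s sF) r))
    (smooth-* {d = 1} (smooth-const (divides 1ℤ refl)) (Δ[2^]-smooth s sF r)))

∣Δ⇒∣-multiple : ∀ {d} h G → (∀ β → d ∣ˢ Δ[ h ] G β) → ∀ k β → d ∣ˢ G (k ℕ.* h ℕ.+ β) - G β
∣Δ⇒∣-multiple     h G d∣Δ zero    β = divides 0ℤ (ℤ.+-inverseʳ (G β))
∣Δ⇒∣-multiple {d} h G d∣Δ (suc k) β = ∣ˢ-resp-≡ telescope
  (∣m∣n⇒∣m+n {d} {Δ[ h ] G β′} {G β′ - G β} (d∣Δ β′) (∣Δ⇒∣-multiple h G d∣Δ k β))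
  where
  β′ : ℕ
  β′ = k ℕ.* h ℕ.+ β
  cancel : ∀ x y z → (x - y) + (y - z) ≡ x - z
  cancel = solve-∀
  telescope : Δ[ h ] G β′ + (G β′ - G β) ≡ G (suc k ℕ.* h ℕ.+ β) - G β
  telescope = trans (cancel (G (h ℕ.+ β′)) (G β′) (G β))
                    (cong (λ n → G n - G β) (sym (ℕ.+-assoc h (k ℕ.* h) β)))

-- Modulo d the increments along step h are constant, so `F` is an arithmetic progression there.
∣ΔΔ⇒∣-multiple : ∀ {d} h F → (∀ β → d ∣ˢ Δ[ h ] (Δ[ h ] F) β) →
  ∀ k β → d ∣ˢ F (k ℕ.* h ℕ.+ β) - F β - + k * Δ[ h ] F β
∣ΔΔ⇒∣-multiple h F d∣ΔΔ zero    β = divides 0ℤ (vanish (F β) (Δ[ h ] F β))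
  where
  vanish : ∀ x y → x - x - 0ℤ * y ≡ 0ℤ
  vanish = solve-∀
∣ΔΔ⇒∣-multiple {d} h F d∣ΔΔ (suc k) β =
  subst (λ n → d ∣ˢ F n - F β - + suc k * Δ[ h ] F β) (sym (ℕ.+-assoc h (k ℕ.* h) β))
    (telescope (F (h ℕ.+ β′)) (F β′) (F β) (Δ[ h ] F β)
      (∣Δ⇒∣-multiple h (Δ[ h ] F) d∣ΔΔ k β) (∣ΔΔ⇒∣-multiple h F d∣ΔΔ k β))
  where
  β′ : ℕ
  β′ = k ℕ.* h ℕ.+ β
  cancel : ∀ x y z k w → ((x - y) - w) + (y - z - k * w) ≡ x - z - (1ℤ + k) * w
  cancel = solve-∀
  telescope : ∀ x y z w → d ∣ˢ (x - y) - w → d ∣ˢ y - z - + k * w → d ∣ˢ x - z - + suc k * w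
  telescope x y z w d∣₁ d∣₂ = ∣ˢ-resp-≡ (cancel x y z (+ k) w)
    (∣m∣n⇒∣m+n {d} {(x - y) - w} {y - z - + k * w} d∣₁ d∣₂)

-- The case m = 5.

firstDefect-∣ : ∀ j β → 2^ 15 ∣ˢ firstDefect (odd j) (oddPart (odd j)) β
-- Step 16 = 2^4 gives the difference level 5, and the subtracted term carries 2^5; ten values raise
-- this to 2^15.
firstDefect-∣ j = extrapolate {10} {5} {firstDefect a (oddPart a)}
  (smooth-sub (Δ[2^]-smooth 4 (oddPart-smooth a) 10)
    (smooth-* {d = 5} (smooth-const (divides 1ℤ refl))
      (smooth-+ (ψ-smooth (smooth-const₀ a) (smooth-Δ≡2 (λ β → gap (+ suc (β ℕ.* 2)))))
                (smooth-const₀ (2^ 6 * (a ^ 2 - + 1))))))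
  (λ β<10 → firstDefect-at β<10 j)
  where
  a : ℤ
  a = odd j
  gap : ∀ x → (1ℤ + (1ℤ + x)) - x ≡ + 2
  gap = solve-∀

secondDefect-∣ : ∀ j β → 2^ 16 ∣ˢ secondDefect (odd j) (oddPart (odd j)) β
-- Two differences of step 2^4 give level 10.
secondDefect-∣ j = extrapolate {6} {10} {secondDefect a (oddPart a)}
  (smooth-sub (Δ[2^]-smooth 4 (Δ[2^]-smooth 4 (oddPart-smooth a)) 6)
    (smooth-const (divides (+ 4 * (a ^ 2 - + 1)) (regroup (a ^ 2 - + 1)))))
  (λ β<6 → secondDefect-at β<6 j)
  where
  a : ℤ
  a = odd j
  regroup : ∀ c → 2^ 6 * 2^ 6 * c ≡ + 4 * c * 2^ 10
  regroup c = trans (ℤ.*-comm (2^ 6 * 2^ 6) c)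
    (trans (sym (ℤ.*-assoc c (+ 4) (2^ 10))) (cong (_* 2^ 10) (ℤ.*-comm c (+ 4))))

-- Consecutive odd squares differ by 8 (1 + j).
8∣odd²-1 : ∀ j → 2^ 3 ∣ˢ odd j ^ 2 - + 1
8∣odd²-1 = ℤ-connected (λ j → 2^ 3 ∣ˢ odd j ^ 2 - + 1) (divides 0ℤ refl)
  (λ j 8∣ → ∣ˢ-resp-≡ (up j) (∣m∣n⇒∣m+n 8∣ (divides (1ℤ + j) refl)))
  (λ j 8∣ → ∣ˢ-resp-≡ (down j) (∣m∣n⇒∣m-n 8∣ (divides (1ℤ + j) refl)))
  where
  up : ∀ j → ((1ℤ + + 2 * j) * ((1ℤ + + 2 * j) * 1ℤ) - + 1) + (1ℤ + j) * + 8
             ≡ (1ℤ + + 2 * (1ℤ + j)) * ((1ℤ + + 2 * (1ℤ + j)) * 1ℤ) - + 1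
  up = solve-∀
  down : ∀ j → ((1ℤ + + 2 * (1ℤ + j)) * ((1ℤ + + 2 * (1ℤ + j)) * 1ℤ) - + 1) - (1ℤ + j) * + 8
               ≡ (1ℤ + + 2 * j) * ((1ℤ + + 2 * j) * 1ℤ) - + 1
  down = solve-∀

-- Passing from m to m + 1.

+≡⇒≤ : ∀ {m n} k → m ℕ.+ k ≡ n → m ℕ.≤ n
+≡⇒≤ {m} k refl = ℕ.m≤m+n m k

-- In `ΔΔ-double` the term 4 D² carries the congruence over. Third differences contain 2^(3s+3), so
-- 4 D³ vanishes modulo 2^(3s+5), and so does D⁴ because s ≥ 1.
ΔΔ-mod-step : ∀ s e w c {F} → Smooth∞ 0 F → 1 ℕ.≤ s → e ℕ.≤ 4 ℕ.+ (s ℕ.+ (s ℕ.+ s)) → ∀ β →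
  2^ e ∣ˢ Δ[ 2 ℕ.^ s ] (Δ[ 2 ℕ.^ s ] F) β - w * w * c →
  2^ suc e ∣ˢ Δ[ 2 ℕ.^ suc s ] (Δ[ 2 ℕ.^ suc s ] F) β - + 2 * w * (+ 2 * w) * c
ΔΔ-mod-step s e w c {F} sF 1≤s e≤4+3s β e∣ = subst (λ x → 2^ suc e ∣ˢ x - + 2 * w * (+ 2 * w) * c)
  (sym (ΔΔ-double s F β))
  (combine (q β) (D q β) (D (D q) β) e∣
    (2^-weaken {e = 2 ℕ.+ s₃} 1+e≤2+s₃
      (2^-*-∣ 2 s₃ {+ 4} {D q β} (divides 1ℤ refl) (smooth-∣ (smooth₃ 0) β)))
    (2^-weaken {e = suc s ℕ.+ s₃} (ℕ.≤-trans 1+e≤2+s₃ (ℕ.+-monoˡ-≤ s₃ (ℕ.s≤s 1≤s)))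
      (smooth-∣ (Δ[2^]-smooth s {s₃} {D q} smooth₃ 0) β)))
  where
  D : (ℕ → ℤ) → ℕ → ℤ
  D = Δ[ 2 ℕ.^ s ]
  q : ℕ → ℤ
  q = D (D F)
  s₃ : ℕ
  s₃ = suc s ℕ.+ (suc s ℕ.+ (suc s ℕ.+ 0))
  exponent : ∀ s → 5 ℕ.+ (s ℕ.+ (s ℕ.+ s)) ≡ 3 ℕ.+ s ℕ.+ (suc s ℕ.+ (suc s ℕ.+ 0))
  exponent = ℕ-Solver.solve-∀
  1+e≤2+s₃ : suc e ℕ.≤ 2 ℕ.+ s₃
  1+e≤2+s₃ = ℕ.≤-trans (ℕ.s≤s e≤4+3s) (ℕ.≤-reflexive (exponent s))
  smooth₃ : Smooth∞ s₃ (D q)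
  smooth₃ = Δ[2^]-smooth s (Δ[2^]-smooth s (Δ[2^]-smooth s sF))
  regroup : ∀ w c q dq ddq → + 4 * (q - w * w * c) + (+ 4 * dq + ddq)
    ≡ + 4 * q + (+ 4 * dq + ddq) - + 2 * w * (+ 2 * w) * c
  regroup = solve-∀
  combine : ∀ q dq ddq → 2^ e ∣ˢ q - w * w * c →
    2^ suc e ∣ˢ + 4 * dq → 2^ suc e ∣ˢ ddq →
    2^ suc e ∣ˢ + 4 * q + (+ 4 * dq + ddq) - + 2 * w * (+ 2 * w) * c
  combine q dq ddq ∣₁ ∣₂ ∣₃ = ∣ˢ-resp-≡ (regroup w c q dq ddq)
    (∣m∣n⇒∣m+n {2^ suc e} {+ 4 * (q - w * w * c)} {+ 4 * dq + ddq}
      (2^-weaken (ℕ.n≤1+n (suc e)) (2^-*-∣ 2 e {+ 4} {q - w * w * c} (divides 1ℤ refl) ∣₁))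
      (∣m∣n⇒∣m+n {2^ suc e} {+ 4 * dq} {ddq} ∣₂ ∣₃))

Δ-mod-step : ∀ s e u p c F β →
  2^ e ∣ˢ Δ[ 2 ℕ.^ s ] F β - u * (p + + 2 * u * c) →
  2^ suc e ∣ˢ Δ[ 2 ℕ.^ s ] (Δ[ 2 ℕ.^ s ] F) β - + 2 * u * (+ 2 * u) * c →
  2^ suc e ∣ˢ Δ[ 2 ℕ.^ suc s ] F β - + 2 * u * (p + + 2 * (+ 2 * u) * c)
Δ-mod-step s e u p c F β ∣₁ ∣₂ =
  subst (λ x → 2^ suc e ∣ˢ x - + 2 * u * (p + + 2 * (+ 2 * u) * c)) (Δ-double s F β)
    (combine (Δ[ 2 ℕ.^ s ] F β) (Δ[ 2 ℕ.^ s ] (Δ[ 2 ℕ.^ s ] F) β) ∣₁ ∣₂)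
  where
  regroup : ∀ u p c f q →
    (q - + 2 * u * (+ 2 * u) * c) + + 2 * (f - u * (p + + 2 * u * c))
      ≡ q + + 2 * f - + 2 * u * (p + + 2 * (+ 2 * u) * c)
  regroup = solve-∀
  combine : ∀ f q → 2^ e ∣ˢ f - u * (p + + 2 * u * c) →
    2^ suc e ∣ˢ q - + 2 * u * (+ 2 * u) * c →
    2^ suc e ∣ˢ q + + 2 * f - + 2 * u * (p + + 2 * (+ 2 * u) * c)
  combine f q ∣₁ ∣₂ = ∣ˢ-resp-≡ (regroup u p c f q)
    (∣m∣n⇒∣m+n {2^ suc e} {q - + 2 * u * (+ 2 * u) * c} {+ 2 * (f - u * (p + + 2 * u * c))}
      ∣₂ (2^-*-∣ 1 e {+ 2} {f - u * (p + + 2 * u * c)} (divides 1ℤ refl) ∣₁))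

-- Induction on m = t + 5 for a fixed odd parameter.

-- The exponents are written t + n, so that 2^ (t + n) does not unfold.
module _ (j : ℤ) where

  private
    a c : ℤ
    a = odd j
    c = a ^ 2 - + 1

    F : ℕ → ℤ
    F = oddPart a

  ΔΔ-mod : ∀ t β → 2^ (t ℕ.+ 16) ∣ˢ
    Δ[ 2 ℕ.^ (t ℕ.+ 4) ] (Δ[ 2 ℕ.^ (t ℕ.+ 4) ] F) β - 2^ (t ℕ.+ 6) * 2^ (t ℕ.+ 6) * c
  ΔΔ-mod zero    β = secondDefect-∣ j β
  ΔΔ-mod (suc t) β = ΔΔ-mod-step (t ℕ.+ 4) (t ℕ.+ 16) (2^ (t ℕ.+ 6)) c
    (oddPart-smooth a) (ℕ.≤-trans (ℕ.s≤s ℕ.z≤n) (ℕ.m≤n+m 4 t))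
    -- The bound on the exponent is an equality at t = 0.
    (+≡⇒≤ (t ℕ.+ t) (exponent t)) β (ΔΔ-mod t β)
    where
    exponent : ∀ t → t ℕ.+ 16 ℕ.+ (t ℕ.+ t) ≡ 4 ℕ.+ (t ℕ.+ 4 ℕ.+ (t ℕ.+ 4 ℕ.+ (t ℕ.+ 4)))
    exponent = ℕ-Solver.solve-∀

  -- The main term is 2^(2t+12) c with 8 dividing c, so it vanishes modulo 2^(t+15).
  ΔΔ-∣ : ∀ t β → 2^ (t ℕ.+ 15) ∣ˢ Δ[ 2 ℕ.^ (t ℕ.+ 4) ] (Δ[ 2 ℕ.^ (t ℕ.+ 4) ] F) β
  ΔΔ-∣ t β = recombine (2^ (t ℕ.+ 15)) (Δ[ 2 ℕ.^ (t ℕ.+ 4) ] (Δ[ 2 ℕ.^ (t ℕ.+ 4) ] F) β)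
    (2^ (t ℕ.+ 6) * 2^ (t ℕ.+ 6) * c)
    (2^-weaken (ℕ.+-monoʳ-≤ t (ℕ.n≤1+n 15)) (ΔΔ-mod t β))
    (2^-weaken (+≡⇒≤ t (exponent t))
      (2^-*-∣ (t ℕ.+ 6 ℕ.+ (t ℕ.+ 6)) 3 {2^ (t ℕ.+ 6) * 2^ (t ℕ.+ 6)} {c}
        (2^-*-∣ (t ℕ.+ 6) (t ℕ.+ 6) {2^ (t ℕ.+ 6)} {2^ (t ℕ.+ 6)} Signed.∣-refl Signed.∣-refl)
        (8∣odd²-1 j)))
    where
    exponent : ∀ t → t ℕ.+ 15 ℕ.+ t ≡ t ℕ.+ 6 ℕ.+ (t ℕ.+ 6) ℕ.+ 3
    exponent = ℕ-Solver.solve-∀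
    cancel : ∀ x y → (x - y) + y ≡ x
    cancel = solve-∀
    recombine : ∀ d x y → d ∣ˢ x - y → d ∣ˢ y → d ∣ˢ x
    recombine d x y ∣₁ ∣₂ = ∣ˢ-resp-≡ (cancel x y) (∣m∣n⇒∣m+n {d} {x - y} {y} ∣₁ ∣₂)

  Δ-mod : ∀ t β → 2^ (t ℕ.+ 15) ∣ˢ
    Δ[ 2 ℕ.^ (t ℕ.+ 4) ] F β - 2^ (t ℕ.+ 5) * (ψ a (+ suc (β ℕ.* 2)) + + 2 * 2^ (t ℕ.+ 5) * c)
  Δ-mod zero    β = firstDefect-∣ j β
  Δ-mod (suc t) β = Δ-mod-step (t ℕ.+ 4) (t ℕ.+ 15) (2^ (t ℕ.+ 5)) (ψ a (+ suc (β ℕ.* 2))) c F β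
    (Δ-mod t β)
    (subst₂ (λ e u → 2^ e ∣ˢ Δ[ 2 ℕ.^ (t ℕ.+ 4) ] (Δ[ 2 ℕ.^ (t ℕ.+ 4) ] F) β - u * u * c)
      (ℕ.+-suc t 15) (cong 2^_ (ℕ.+-suc t 5)) (ΔΔ-mod t β))

  -- By `ΔΔ-∣` the dependence on k is linear, and `Δ-mod` gives the slope.
  oddPart-mod : ∀ t k β → 2^ (t ℕ.+ 15) ∣ˢ
    (F (k ℕ.* 2 ℕ.^ (t ℕ.+ 4) ℕ.+ β) - F β)
      - 2^ (t ℕ.+ 5) * + k * (ψ a (+ suc (β ℕ.* 2)) + + 2 * 2^ (t ℕ.+ 5) * c)
  oddPart-mod t k β = combine (2^ (t ℕ.+ 15)) (F (k ℕ.* 2 ℕ.^ (t ℕ.+ 4) ℕ.+ β) - F β) (+ k)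
    (Δ[ 2 ℕ.^ (t ℕ.+ 4) ] F β) (2^ (t ℕ.+ 5)) (ψ a (+ suc (β ℕ.* 2)) + + 2 * 2^ (t ℕ.+ 5) * c)
    (∣ΔΔ⇒∣-multiple (2 ℕ.^ (t ℕ.+ 4)) F (ΔΔ-∣ t) k β) (Δ-mod t β)
    where
    regroup : ∀ f k d u p → (f - k * d) + k * (d - u * p) ≡ f - u * k * p
    regroup = solve-∀
    combine : ∀ e f k d u p → e ∣ˢ f - k * d → e ∣ˢ d - u * p → e ∣ˢ f - u * k * p
    combine e f k d u p ∣₁ ∣₂ = ∣ˢ-resp-≡ (regroup f k d u p)
      (∣m∣n⇒∣m+n {e} {f - k * d} {k * (d - u * p)} ∣₁ (∣n⇒∣m*n k ∣₂))

-- Translation to the stated congruence.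

pos-2^ : ∀ n → + (2 ℕ.^ n) ≡ 2^ n
pos-2^ zero    = refl
pos-2^ (suc n) = trans (ℤ.pos-* 2 (2 ℕ.^ n)) (cong (+ 2 *_) (pos-2^ n))

odd-ℤ : ∀ a → ¬ (+ 2 ∣ a) → ∃[ j ] a ≡ odd j
odd-ℤ a 2∤a with a ℤ.%ℕ 2 | ℤ.a≡a%ℕn+[a/ℕn]*n a 2 | ℤ.n%ℕd<d a 2
... | 0 | eq | _ = contradiction
  (∣⇒∣ᵤ {+ 2} {a} (divides (a ℤ./ℕ 2) (trans eq (ℤ.+-identityˡ _)))) 2∤a
... | 1 | eq | _ = a ℤ./ℕ 2 , trans eq (cong (λ x → 1ℤ + x) (ℤ.*-comm (a ℤ./ℕ 2) (+ 2)))
... | suc (suc _) | _ | ℕ.s≤s (ℕ.s≤s ())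

odd-ℕ : ∀ b → ¬ (2 ℕ.∣ b) → ∃[ β ] b ≡ suc (β ℕ.* 2)
odd-ℕ b 2∤b with b ℕ.% 2 | ℕ.m≡m%n+[m/n]*n b 2 | ℕ.m%n<n b 2
... | 0 | eq | _ = contradiction (ℕ.divides (b ℕ./ 2) eq) 2∤b
... | 1 | eq | _ = b ℕ./ 2 , eq
... | suc (suc _) | _ | ℕ.s≤s (ℕ.s≤s ())

∣ˢ⇒≡mod : ∀ n x y → + n ∣ˢ x - y → x ≡ y [mod n ]
∣ˢ⇒≡mod n x y = ∣⇒∣ᵤ {+ n} {x - y}

oddPart≡E : ∀ a β {n} → suc (β ℕ.* 2) ≡ n → oddPart a β ≡ E a n
oddPart≡E a β refl = sym (E≡R a (suc (β ℕ.* 2)))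

-- The equations travel with their witnesses, so that matching on `refl` puts a, b and m into the
-- shape that `oddPart-mod` uses.
E-mod : ∀ {a b m} k → ∃[ j ] a ≡ odd j → ∃[ β ] b ≡ suc (β ℕ.* 2) → ∃[ t ] t ℕ.+ 5 ≡ m →
  E a (2 ℕ.^ m ℕ.* k ℕ.+ b) - E a b
    ≡ 2^ m * + k * (ψ a (+ b) + 2^ (m ℕ.+ 1) * (a ^ 2 - + 1)) [mod 2 ℕ.^ (m ℕ.+ 10) ]
E-mod k (j , refl) (β , refl) (t , refl) =
  ∣ˢ⇒≡mod (2 ℕ.^ (t ℕ.+ 5 ℕ.+ 10))
    (E (odd j) (2 ℕ.^ (t ℕ.+ 5) ℕ.* k ℕ.+ n) - E (odd j) n) (formula (2^ (t ℕ.+ 5 ℕ.+ 1)))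
    (transport modulus (oddPart≡E (odd j) (k ℕ.* 2 ℕ.^ (t ℕ.+ 4) ℕ.+ β) shift)
      (oddPart≡E (odd j) β refl)
      (cong formula {+ 2 * 2^ (t ℕ.+ 5)} {2^ (t ℕ.+ 5 ℕ.+ 1)} (cong 2^_ (ℕ.+-comm 1 (t ℕ.+ 5))))
      (oddPart-mod j t k β))
  where
  transport : ∀ {d d′ x x′ y y′ z z′ : ℤ} → d ≡ d′ → x ≡ x′ → y ≡ y′ → z ≡ z′ →
    d ∣ˢ x - y - z → d′ ∣ˢ x′ - y′ - z′
  transport refl refl refl refl d∣ = d∣
  n : ℕ
  n = suc (β ℕ.* 2)
  modulus : 2^ (t ℕ.+ 15) ≡ + (2 ℕ.^ (t ℕ.+ 5 ℕ.+ 10))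
  modulus = trans (cong 2^_ (sym (ℕ.+-assoc t 5 10))) (sym (pos-2^ (t ℕ.+ 5 ℕ.+ 10)))
  index : ∀ h k β → suc ((k ℕ.* h ℕ.+ β) ℕ.* 2) ≡ 2 ℕ.* h ℕ.* k ℕ.+ suc (β ℕ.* 2)
  index = ℕ-Solver.solve-∀
  -- With n = 1 + 2β, a step 2^(t+4) in β is a step 2^(t+5) in n.
  shift : suc ((k ℕ.* 2 ℕ.^ (t ℕ.+ 4) ℕ.+ β) ℕ.* 2) ≡ 2 ℕ.^ (t ℕ.+ 5) ℕ.* k ℕ.+ n
  shift = trans (index (2 ℕ.^ (t ℕ.+ 4)) k β)
                (cong (λ e → 2 ℕ.^ e ℕ.* k ℕ.+ n) (sym (ℕ.+-suc t 4)))
  formula : ℤ → ℤ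
  formula x = 2^ (t ℕ.+ 5) * + k * (ψ (odd j) (+ n) + x * (odd j ^ 2 - + 1))

theorem2p3 : (a : ℤ) → ¬ (+ 2 ∣ a) →
    (k m : ℕ) → 1 ℕ.≤ k → 5 ℕ.≤ m →
    (b : ℕ) → ¬ (2 ℕ.∣ b) →
    E a (2 ℕ.^ m ℕ.* k ℕ.+ b) - E a b
    ≡ (+ 2) ^ m * (+ k) *
    ( (+ 17 * a ^ 7 + + 162 * a ^ 5 + + 153 * a ^ 3 + + 64 * a ^ 2 + + 180 * a + + 192) * (+ b) ^ 2
    - (+ 102 * a ^ 7 + + 216 * a ^ 5 + + 386 * a ^ 3 - + 704 * a) * (+ b)
    - (+ 211 * a ^ 7 - + 10 * a ^ 5 - + 32 * a ^ 4 + + 66 * a ^ 3 - + 267 * a - + 224)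
    + (+ 2) ^ (m ℕ.+ 1) * (a ^ 2 - + 1))
    [mod 2 ℕ.^ (m ℕ.+ 10) ]
theorem2p3 a 2∤a k m _ 5≤m b 2∤b =
  E-mod k (odd-ℤ a 2∤a) (odd-ℕ b 2∤b) (m ℕ.∸ 5 , ℕ.m∸n+n≡m 5≤m)
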